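{- For distinct integers $m,m'\geq3$, there is no pair of Borel maps $\phi\colon([\omega]^\omega)^{2^{m'}}\to([\omega]^\omega)^{2^m}$ and $\psi\colon2^\omega\to2^\omega$ such that for all $\bar A=(A_1,\ldots,A_{2^{m'}})\in([\omega]^\omega)^{2^{m'}}$ and all $c\in2^\omega$: whenever $c$ splits at least $m$ of the coordinates of $\phi(\bar A)$, $\psi(c)$ splits at least $m'$ of $A_1,\ldots,A_{2^{m'}}$. In other words, the Vojtáš triples $\mathfrak s_{2^m,m}$, $m\geq3$, form an antichain in the Borel Tukey order.
   Context: $[\omega]^\omega$ is the space of infinite subsets of $\omega$. An element $c\in2^\omega$ splits an infinite set $A\subseteq\omega$ if $c\restriction A$ takes both values $0$ and $1$ infinitely often. $\mathfrak s_{n,m}$ denotes the Vojtáš triple $(([\omega]^\omega)^n,2^\omega,\mathsf S_{n,m})$, where $(A_1,\ldots,A_n)\mathrel{\mathsf S_{n,m}}c$ iff $c$ splits at least $m$ of $A_1,\ldots,A_n$. A Borel Tukey morphism from $(A_-,A_+,\mathsf A)$ to $(B_-,B_+,\mathsf B)$ is a pair of Borel maps $\phi\colon B_-\to A_-$, $\psi\colon A_+\to B_+$ with $\phi(b)\mathrel{\mathsf A}a\Rightarrow b\mathrel{\mathsf B}\psi(a)$; the Borel Tukey order is $\mathbf A\geq_{BT}\mathbf B$ iff such a morphism exists. -}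

module Defs where

open import Data.Nat using (ℕ; _≤_; _^_)
open import Data.Bool using (Bool; true; false)
open import Data.Fin using (Fin)
open import Data.Product using (Σ; ∃; _×_; _,_)
open import Relation.Binary.PropositionalEquality using (_≡_)
open import Relation.Nullary using (¬_)
open import Function.Definitions using (Injective)
open import Function.Bundles using (_⇔_)

-- Points of the product space 2^C (C a countable index type), i.e. C → Bool.
-- Borel sets of 2^C, given by codes: the σ-algebra generated by the
-- subbasic clopen sets {x | x c ≡ b}, closed under complement and countable union.
data BorelCode (C : Set) : Set where
  cyl   : C → Bool → BorelCode C
  compl : BorelCode C → BorelCode C
  ⋃     : (ℕ → BorelCode C) → BorelCode C

⟦_⟧ : {C : Set} → BorelCode C → (C → Bool) → Set
⟦ cyl c b ⟧ x = x c ≡ b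
⟦ compl B ⟧ x = ¬ ⟦ B ⟧ x
⟦ ⋃ F ⟧ x = ∃ λ n → ⟦ F n ⟧ x

IsBorelMap : {C D : Set} → ((C → Bool) → (D → Bool)) → Set
IsBorelMap {C} {D} f =
  (d : D) (b : Bool) → Σ (BorelCode C) λ B → (x : C → Bool) → (f x d ≡ b) ⇔ ⟦ B ⟧ x

Cantor : Set
Cantor = ℕ → Bool

-- Tuples of length k of subsets of ω, as points of 2^(Fin k × ℕ).
Tuple : ℕ → Set
Tuple k = Fin k × ℕ → Bool

Infinite : Cantor → Set
Infinite A = (n : ℕ) → ∃ λ j → n ≤ j × A j ≡ true

coord : {k : ℕ} → Tuple k → Fin k → Cantor
coord x i n = x (i , n)

AllInfinite : {k : ℕ} → Tuple k → Set
AllInfinite x = ∀ i → Infinite (coord x i)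

Splits : Cantor → Cantor → Set
Splits c A =
  ((n : ℕ) → ∃ λ j → n ≤ j × A j ≡ true × c j ≡ false) ×
  ((n : ℕ) → ∃ λ j → n ≤ j × A j ≡ true × c j ≡ true)

SplitsAtLeast : (m : ℕ) {k : ℕ} → Cantor → Tuple k → Set
SplitsAtLeast m {k} c x =
  Σ (Fin m → Fin k) λ f → Injective _≡_ _≡_ f × ((j : Fin m) → Splits c (coord x (f j)))

record BorelTukeyMorphism (n m n' m' : ℕ) : Set where
  field
    φ        : Tuple n' → Tuple n
    ψ        : Cantor → Cantor
    φ-borel  : IsBorelMap φ
    ψ-borel  : IsBorelMap ψ
    φ-infin  : (A : Tuple n') → AllInfinite A → AllInfinite (φ A)
    morphism : (A : Tuple n') (c : Cantor) → AllInfinite A →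
               SplitsAtLeast m c (φ A) → SplitsAtLeast m' (ψ c) A

{-# OPTIONS --safe #-}
module Submission where

-- An infinite set b = {b₀ < b₁ < …} codes the tuple with A_j = {b_r : r ≡ j mod n′}.  By
-- Galvin–Prikry and fusion, for b inside a sufficiently sparse set the part of φ(A)_i below a
-- point of the sparse set depends only on the elements of b chosen so far: either a finite stem
-- already determines infinitely many elements of φ(A)_i, or new elements of φ(A)_i appear only
-- next to a freshly chosen element of b, which carries a label j. Deciding, for all pairs (i , j),
-- whether the events of i at label j can be avoided for good, one gets a condition and a label
-- a(i) for every i whose events can always be produced. Let c alternate along blocks of the sparse
-- set, and let J be a set of labels.  Take the elements labelled outside J from sets on which ψ(c)
-- is constant, and those labelled in J so as to produce events in both colours.  Then c splits
-- φ(A)_i whenever a(i) ∈ J, but ψ(c) splits A_j only for j ∈ J.  Hence |J| < m′ forces fewer than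
-- m indices i with a(i) ∈ J.  If m < m′, this fails for the image J of any m indices; if m > m′,
-- it fails for m′ − 1 greedily chosen large fibres of a.

open import Defs
open import Level using (0ℓ)
open import Axiom.ExcludedMiddle using (ExcludedMiddle)
open import Data.Bool using (Bool; true; false)
open import Data.Bool.Properties using (¬-not)
open import Data.Empty using (⊥; ⊥-elim)
open import Data.Fin using (Fin; zero; suc; toℕ; fromℕ<; inject≤)
open import Data.Fin.Properties
  using (toℕ-fromℕ<; toℕ<n; toℕ-injective; any?; inject≤-injective; injective⇒≤)
  renaming (_≟_ to _≟ᶠ_)
open import Data.List using (List; []; _∷_; length; map; filter; lookup; allFin)
open import Data.List.Membership.Propositional.Properties using (∈-lookup)
open import Data.List.Properties using
  (length-map; length-tabulate; filter-all; filter-none; ∷-injectiveˡ; ∷-injectiveʳ)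
open import Data.List.Relation.Unary.All as All using (universal)
open import Data.List.Relation.Unary.All.Properties using (all-filter)
open import Data.List.Relation.Unary.AllPairs using (_∷_)
open import Data.List.Relation.Unary.Unique.Propositional using (Unique)
open import Data.List.Relation.Unary.Unique.Propositional.Properties using (allFin⁺; filter⁺)
open import Data.Nat using
  (ℕ; zero; suc; _+_; _*_; _∸_; _^_; _⊔_; _≤_; _<_; _≟_; _≤?_; _<?_; z≤n; s≤s; s≤s⁻¹; NonZero)
open import Data.Nat.DivMod using (_%_; m%n<n; [m+kn]%n≡m%n; m<n⇒m%n≡m)
open import Data.Nat.Properties hiding (_≟_; _≤?_; _<?_)
open import Data.Nat.Tactic.RingSolver using (solve-∀)
open import Data.Product using (Σ; ∃; _×_; _,_; proj₁; proj₂)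
open import Data.Sum using (_⊎_; inj₁; inj₂; [_,_]′)
open import Data.Unit using (⊤; tt)
import Data.Vec.Functional as Vector
open import Function using (_∘_; id; case_of_)
open import Function.Bundles using (Equivalence)
open import Function.Definitions using (Injective)
open import Relation.Binary.Definitions using (tri<; tri≈; tri>)
open import Relation.Binary.PropositionalEquality
open import Relation.Nullary using (¬_; Dec; yes; no; does; contradiction; ¬?)
open import Relation.Unary using (Decidable)

-- Infinite sets and their finite stems

Unbounded : (ℕ → Set) → Set
Unbounded Q = ∀ n → ∃ λ x → n ≤ x × Q x

record InfSet : Set where
  constructor infSet
  field
    enum : ℕ → ℕ
    inc  : ∀ k → enum k < enum (suc k)

  enum-mono-≤ : ∀ {k l} → k ≤ l → enum k ≤ enum l
  enum-mono-≤ {l = zero}  z≤n = ≤-refl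
  enum-mono-≤ {l = suc l} k≤l with m≤n⇒m<n∨m≡n k≤l
  ... | inj₁ (s≤s k≤l′) = ≤-trans (enum-mono-≤ k≤l′) (<⇒≤ (inc l))
  ... | inj₂ refl       = ≤-refl

  enum-mono-< : ∀ {k l} → k < l → enum k < enum l
  enum-mono-< k<l = <-≤-trans (inc _) (enum-mono-≤ k<l)

  enum-cancel-< : ∀ {k l} → enum k < enum l → k < l
  enum-cancel-< {k} {l} p with k ≤? l
  ... | yes k≤l = ≤∧≢⇒< k≤l λ { refl → <-irrefl refl p }
  ... | no  k≰l = ⊥-elim (<-asym p (enum-mono-< (≰⇒> k≰l)))

  k≤enum : ∀ k → k ≤ enum k
  k≤enum zero    = z≤n
  k≤enum (suc k) = ≤-<-trans (k≤enum k) (inc k)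

  locate : ∀ {a x} → enum a ≤ x → ∃ λ l → a ≤ l × enum l ≤ x × x < enum (suc l)
  locate {a} {zero} p with enum (suc a) ≤? 0
  ... | yes q = contradiction (≤-trans (inc a) q) λ ()
  ... | no  q = a , ≤-refl , p , ≰⇒> q
  locate {a} {suc x} p with m≤n⇒m<n∨m≡n p
  ... | inj₂ eq = a , ≤-refl , p , subst (_< enum (suc a)) eq (inc a)
  ... | inj₁ (s≤s p′) with locate p′
  ... | l , a≤l , l≤x , x<l′ with m≤n⇒m<n∨m≡n x<l′
  ... | inj₁ x<  = l , a≤l , m≤n⇒m≤1+n l≤x , x<
  ... | inj₂ eq  = suc l , m≤n⇒m≤1+n a≤l , ≤-reflexive (sym eq) ,
                   subst (_< enum (suc (suc l))) (sym eq) (inc (suc l))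

open InfSet

infix 4 _∈_ _⊆_

data _∈_ : ℕ → InfSet → Set where
  at : ∀ {S} k → enum S k ∈ S

record _⊆_ (S T : InfSet) : Set where
  constructor sub
  field
    mem : ∀ {x} → x ∈ S → x ∈ T

open _⊆_

⊆-refl : ∀ {S} → S ⊆ S
⊆-refl = sub id

⊆-trans : ∀ {S T U} → S ⊆ T → T ⊆ U → S ⊆ U
⊆-trans p q = sub (mem q ∘ mem p)

∈-unbounded : ∀ S → Unbounded (_∈ S)
∈-unbounded S n = enum S n , k≤enum S n , at n

_∘ₛ_ : InfSet → InfSet → InfSet
(p ∘ₛ κ) .enum   = enum p ∘ enum κ
(p ∘ₛ κ) .inc k = enum-mono-< p (inc κ k)

abstract
  thinBy : (g : ℕ → ℕ) {Q : ℕ → Set} → Unbounded Q →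
           Σ InfSet λ S → (∀ {x} → x ∈ S → Q x) × (∀ k → g (enum S k) < enum S (suc k))
  thinBy g {Q} u = infSet f (λ k → ≤-<-trans (m≤m⊔n (f k) (g (f k))) (gap k)) ,
    (λ { (at k) → good k }) , λ k → ≤-<-trans (m≤n⊔m (f k) (g (f k))) (gap k)
    where
    f : ℕ → ℕ
    f zero    = proj₁ (u 0)
    f (suc k) = proj₁ (u (suc (f k ⊔ g (f k))))
    gap : ∀ k → f k ⊔ g (f k) < f (suc k)
    gap k = proj₁ (proj₂ (u (suc (f k ⊔ g (f k)))))
    good : ∀ k → Q (f k)
    good zero    = proj₂ (proj₂ (u 0))
    good (suc k) = proj₂ (proj₂ (u (suc (f k ⊔ g (f k)))))

thin : {Q : ℕ → Set} → Unbounded Q → Σ InfSet λ S → ∀ {x} → x ∈ S → Q x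
thin u with thinBy id u
... | S , S⊆Q , _ = S , S⊆Q

above : ∀ n S → Σ InfSet λ S′ → S′ ⊆ S × (∀ {x} → x ∈ S′ → n < x)
above n S with thin {λ x → x ∈ S × n < x}
                 (λ m → let x , m≤x , x∈S = ∈-unbounded S (m ⊔ suc n) in
                    x , ≤-trans (m≤m⊔n m (suc n)) m≤x , x∈S , ≤-trans (m≤n⊔m m (suc n)) m≤x)
... | S′ , h = S′ , sub (proj₁ ∘ h) , proj₂ ∘ h

-- Finite increasing sequences are lists with the largest entry at the head.
data Below : List ℕ → ℕ → Set where
  []  : ∀ {N} → Below [] N
  _∷_ : ∀ {x t N} → x < N → Below t x → Below (x ∷ t) N

Below-mono : ∀ {t M N} → M ≤ N → Below t M → Below t N
Below-mono M≤N []        = []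
Below-mono M≤N (x< ∷ t<) = <-≤-trans x< M≤N ∷ t<

prefix : (ℕ → ℕ) → ℕ → List ℕ
prefix f zero    = []
prefix f (suc k) = f k ∷ prefix f k

length-prefix : ∀ f k → length (prefix f k) ≡ k
length-prefix f zero    = refl
length-prefix f (suc k) = cong suc (length-prefix f k)

prefix-Below : ∀ b k → Below (prefix (enum b) k) (enum b k)
prefix-Below b zero    = []
prefix-Below b (suc k) = inc b k ∷ prefix-Below b k

prefix-≡ : ∀ {f g} k → prefix f k ≡ prefix g k → ∀ {r} → r < k → f r ≡ g r
prefix-≡ (suc k) eq (s≤s r≤k) with m≤n⇒m<n∨m≡n r≤k
... | inj₁ r<k  = prefix-≡ k (∷-injectiveʳ eq) r<k
... | inj₂ refl = ∷-injectiveˡ eq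

-- With `Q` equal to `_∈ S` these are the basic neighbourhoods of the Ellentuck topology. A free `Q`
-- allows lower bounds on the tail to be added without building a new infinite set.
record Branch (t : List ℕ) (Q : ℕ → Set) (b : InfSet) : Set where
  constructor branch
  field
    stem : prefix (enum b) (length t) ≡ t
    tail : ∀ r → length t ≤ r → Q (enum b r)

open Branch

Branch-mono : ∀ {t Q Q′ b} → (∀ {x} → Q x → Q′ x) → Branch t Q b → Branch t Q′ b
Branch-mono Q⊆ (branch eq h) = branch eq λ r r≥ → Q⊆ (h r r≥)

Branch-prefix : ∀ {t Q} b k → length t ≤ k → Branch t Q b → Branch (prefix (enum b) k) Q b
Branch-prefix b k t≤k (branch _ h) = branch (cong (prefix (enum b)) (length-prefix (enum b) k))
  λ r k≤r → h r (≤-trans t≤k (subst (_≤ r) (length-prefix (enum b) k) k≤r))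

Branch-suc : ∀ {t Q} b k → length t ≤ k → Branch t Q b →
             Branch (prefix (enum b) (suc k)) (λ x → Q x × enum b k < x) b
Branch-suc b k t≤k (branch _ h) = branch (cong (prefix (enum b)) (length-prefix (enum b) (suc k)))
  λ r k<r → let k<r′ = subst (_≤ r) (length-prefix (enum b) (suc k)) k<r in
    h r (≤-trans t≤k (<⇒≤ k<r′)) , enum-mono-< b k<r′

Branch-Below : ∀ {t Q b} → Branch t Q b → Below t (enum b (length t))
Branch-Below {t} {b = b} (branch eq _) =
  subst (λ u → Below u (enum b (length t))) eq (prefix-Below b (length t))

-- Dense and persistent requirements

module Density {C : Set} (_≼_ : C → C → Set)
               (≼-refl : ∀ {c} → c ≼ c) (≼-trans : ∀ {a b c} → a ≼ b → b ≼ c → a ≼ c) where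

  -- Here `c′ ≼ c` means that `c′` is stronger. Finitely many dense requirements are met one after
  -- another, and persistence preserves those already met. The same scheme serves for infinite sets,
  -- numbers, game conditions and stems.
  Persistent Dense : (C → Set) → Set
  Persistent R = ∀ {c c′} → c′ ≼ c → R c → R c′
  Dense R      = ∀ c → ∃ λ c′ → c′ ≼ c × R c′

  abstract
    both : ∀ {R R′} → Persistent R → Dense R → Dense R′ → Dense (λ c → R c × R′ c)
    both per den den′ c =
      let c₁ , c₁≼ , r  = den c
          c₂ , c₂≼ , r′ = den′ c₁
      in c₂ , ≼-trans c₂≼ c₁≼ , per c₂≼ r , r′

    all-Fin : ∀ {k} {R : Fin k → C → Set} → (∀ i → Persistent (R i)) → (∀ i → Dense (R i)) →
              Dense (λ c → ∀ i → R i c)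
    all-Fin {zero}  per den c = c , ≼-refl , λ ()
    all-Fin {suc k} per den c
      with both (per zero) (den zero) (all-Fin (per ∘ suc) (den ∘ suc)) c
    ... | c′ , c′≼ , r , rs = c′ , c′≼ , λ { zero → r ; (suc i) → rs i }

    all-< : ∀ N {R : ℕ → C → Set} → (∀ i → Persistent (R i)) → (∀ i → Dense (R i)) →
            Dense (λ c → ∀ i → i < N → R i c)
    all-< N {R} per den c with all-Fin {N} {R ∘ toℕ} (per ∘ toℕ) (den ∘ toℕ) c
    ... | c′ , c′≼ , rs = c′ , c′≼ ,
      λ i i<N → subst (λ j → R j c′) (toℕ-fromℕ< i<N) (rs (fromℕ< i<N))

    -- Finitely many lists are involved: a list below `suc N` is either below `N` or has head `N`
    -- and a tail below `N`.
    all-Below : ∀ N {R : List ℕ → C → Set} → (∀ t → Persistent (R t)) → (∀ t → Dense (R t)) →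
                Dense (λ c → ∀ t → Below t N → R t c)
    all-Below zero    per den c =
      let c′ , c′≼ , r = den [] c in c′ , c′≼ , λ { .[] [] → r ; _ (() ∷ _) }
    all-Below (suc N) {R} per den c
      with both (λ c′≼c rs t b → per t c′≼c (rs t b)) (all-Below N per den)
                (all-Below N (per ∘ (N ∷_)) (den ∘ (N ∷_))) c
    ... | c′ , c′≼ , rs , rs′ = c′ , c′≼ , go
      where
      go : ∀ t → Below t (suc N) → R t c′
      go .[] [] = rs [] []
      go (x ∷ t) (s≤s x≤N ∷ t<) with m≤n⇒m<n∨m≡n x≤N
      ... | inj₁ x<N  = rs (x ∷ t) (x<N ∷ t<)
      ... | inj₂ refl = rs′ t t<

open Density _⊆_ ⊆-refl ⊆-trans

-- Larger numbers are stronger, so a dense persistent property is one that holds from some number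
-- on; the finite conjunctions yield common bounds.
module Up = Density (λ (m n : ℕ) → n ≤ m) ≤-refl (λ b≤a c≤b → ≤-trans c≤b b≤a)

-- Fusion and the Galvin–Prikry theorem

-- `N` acts as a zeroth stage, at which the stems with entries up to `N` are treated before `D` has
-- any element.
Fused : (ℕ → List ℕ → InfSet → Set) → ℕ → InfSet → Set
Fused P N S = Σ InfSet λ D → D ⊆ S × (∀ {x} → x ∈ D → N < x) ×
  (∀ d → d ≡ N ⊎ d ∈ D → ∀ t → Below t (suc d) →
    Σ InfSet λ S′ → P d t S′ × (∀ {x} → x ∈ D → d < x → x ∈ S′))

abstract
  -- Only finitely many stems have entries at most `d`. At stage `d` the current set is shrunk for
  -- all of them in turn, and every later point is taken from the shrunk set.
  fusion : (P : ℕ → List ℕ → InfSet → Set) →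
           (∀ d t → Persistent (P d t)) → (∀ d t → Dense (P d t)) →
           ∀ N S → Fused P N S
  fusion P per den N S = D , D⊆S , N<D , fused
    where
    shrink : ∀ d S → Σ InfSet λ S′ → S′ ⊆ S × (∀ t → Below t (suc d) → P d t S′)
    shrink d S = all-Below (suc d) (per d) (den d) S

    next : ℕ × InfSet → ℕ × InfSet
    -- The index `suc d` makes the new point exceed `d`.
    next (d , S) = let S′ = proj₁ (shrink d S) in enum S′ (suc d) , S′

    state : ℕ → ℕ × InfSet
    state zero    = N , S
    state (suc k) = next (state k)

    δ : ℕ → ℕ
    δ = proj₁ ∘ state
    σ : ℕ → InfSet
    σ = proj₂ ∘ state

    δ-inc : ∀ k → δ k < δ (suc k)
    δ-inc k = k≤enum (σ (suc k)) (suc (δ k))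

    Δ : InfSet
    Δ = infSet δ δ-inc

    σ-anti : ∀ {k l} → k ≤ l → σ l ⊆ σ k
    σ-anti {l = zero}  z≤n = ⊆-refl
    σ-anti {k} {suc l} k≤l with m≤n⇒m<n∨m≡n k≤l
    ... | inj₁ (s≤s k≤l′) = ⊆-trans (proj₁ (proj₂ (shrink (δ l) (σ l)))) (σ-anti k≤l′)
    ... | inj₂ refl       = ⊆-refl

    D : InfSet
    D = infSet (δ ∘ suc) (δ-inc ∘ suc)

    δ∈σ : ∀ k → δ (suc k) ∈ σ (suc k)
    δ∈σ k = at (suc (δ k))

    D⊆S : D ⊆ S
    D⊆S = sub λ { (at k) → mem (σ-anti {0} {suc k} z≤n) (δ∈σ k) }

    N<D : ∀ {x} → x ∈ D → N < x
    N<D (at k) = enum-mono-< Δ {0} {suc k} (s≤s z≤n)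

    fused-at : ∀ k t → Below t (suc (δ k)) →
               Σ InfSet λ S′ → P (δ k) t S′ × (∀ {x} → x ∈ D → δ k < x → x ∈ S′)
    fused-at k t t< = σ (suc k) , proj₂ (proj₂ (shrink (δ k) (σ k))) t t< , D-tail
      where
      D-tail : ∀ {x} → x ∈ D → δ k < x → x ∈ σ (suc k)
      D-tail (at l) δk< = mem (σ-anti (enum-cancel-< Δ {k} {suc l} δk<)) (δ∈σ l)

    fused : ∀ d → d ≡ N ⊎ d ∈ D → ∀ t → Below t (suc d) →
            Σ InfSet λ S′ → P d t S′ × (∀ {x} → x ∈ D → d < x → x ∈ S′)
    fused d (inj₁ refl)       = fused-at 0
    fused _ (inj₂ (at k)) = fused-at (suc k)

Homogeneous : (InfSet → Set) → List ℕ → InfSet → Set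
Homogeneous X t S = (∀ b → Branch t (_∈ S) b → X b) ⊎ (∀ b → Branch t (_∈ S) b → ¬ X b)

-- The classical completely Ramsey sets: the stem is kept and only the reservoir shrinks.
Ramsey : (InfSet → Set) → Set
Ramsey X = ∀ t → Dense (Homogeneous X t)

Homogeneous-persistent : ∀ X t → Persistent (Homogeneous X t)
Homogeneous-persistent X t S′⊆S (inj₁ h) = inj₁ λ b → h b ∘ Branch-mono (mem S′⊆S)
Homogeneous-persistent X t S′⊆S (inj₂ h) = inj₂ λ b → h b ∘ Branch-mono (mem S′⊆S)

Homogeneous-⇔ : ∀ {X Y} → (∀ b → X b → Y b) → (∀ b → Y b → X b) →
                ∀ {t S} → Homogeneous X t S → Homogeneous Y t S
Homogeneous-⇔ f g (inj₁ h) = inj₁ λ b b∈ → f b (h b b∈)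
Homogeneous-⇔ f g (inj₂ h) = inj₂ λ b b∈ y → h b b∈ (g b y)

module Classical (em : ExcludedMiddle 0ℓ) where

  em? : (P : Set) → Dec P
  em? P = em

  ¬¬-elim : {P : Set} → ¬ ¬ P → P
  ¬¬-elim {P} ¬¬p with em? P
  ... | yes p = p
  ... | no ¬p = ⊥-elim (¬¬p ¬p)

  ¬unbounded : {Q : ℕ → Set} → ¬ Unbounded Q → ∃ λ n → ∀ x → n ≤ x → ¬ Q x
  ¬unbounded {Q} ¬u = ¬¬-elim λ ¬b → ¬u λ n → ¬¬-elim λ ¬x →
    ¬b (n , λ x n≤x q → ¬x (x , n≤x , q))

  -- The countable union step of the Galvin–Prikry theorem, by Nash-Williams' combinatorial forcing:
  -- if the stem t is rejected, a first fusion decides all stems and a second one keeps them rejected.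
  Ramsey-⋃ : (X : ℕ → InfSet → Set) → (∀ n → Ramsey (X n)) → Ramsey (λ b → ∃ λ n → X n b)
  Ramsey-⋃ X ram t S with em? (∃ λ N → Below t N)
  -- A list that is not decreasing is the stem of no branch.
  ... | no ¬t< = S , ⊆-refl , inj₁ λ b b∈ → ⊥-elim (¬t< (_ , Branch-Below b∈))
  ... | yes (N , t<N) with em? (Σ InfSet λ S′ → S′ ⊆ S × (∀ b → Branch t (_∈ S′) b → ∃ λ n → X n b))
  ... | yes (S′ , S′⊆S , acc) = S′ , S′⊆S , inj₁ acc
  ... | no  ¬acc = D₂ , ⊆-trans D₂⊆D₁ D₁⊆S , inj₂ avoids
    where
    Accepts Rejects : List ℕ → InfSet → Set
    Accepts u S′ = ∀ b → Branch u (_∈ S′) b → ∃ λ n → X n b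
    Rejects u S′ = ∀ S″ → S″ ⊆ S′ → ¬ Accepts u S″

    -- Stage `d` decides only the `X n` with `n ≤ d`, which keeps it finite; every `n` is reached at
    -- some stage.
    P₁ : ℕ → List ℕ → InfSet → Set
    P₁ d u S′ = (Accepts u S′ ⊎ Rejects u S′) × (∀ n → n < suc d → Homogeneous (X n) u S′)

    per : ∀ u → Persistent (λ S′ → Accepts u S′ ⊎ Rejects u S′)
    per u S′⊆S (inj₁ a) = inj₁ λ b → a b ∘ Branch-mono (mem S′⊆S)
    per u S′⊆S (inj₂ r) = inj₂ λ S″ S″⊆S′ → r S″ (⊆-trans S″⊆S′ S′⊆S)

    den : ∀ u → Dense (λ S′ → Accepts u S′ ⊎ Rejects u S′)
    den u S′ with em? (Σ InfSet λ S″ → S″ ⊆ S′ × Accepts u S″)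
    ... | yes (S″ , S″⊆ , a) = S″ , S″⊆ , inj₁ a
    ... | no  ¬a             = S′ , ⊆-refl , inj₂ λ S″ S″⊆ a → ¬a (S″ , S″⊆ , a)

    step₁ = fusion P₁
      (λ d u S′⊆S (a , h) → per u S′⊆S a , λ n n<d → Homogeneous-persistent (X n) u S′⊆S (h n n<d))
      (λ d u → both (per u) (den u)
                 (all-< (suc d) (λ n → Homogeneous-persistent (X n) u) (λ n → ram n u)))
      N S

    D₁ : InfSet
    D₁ = proj₁ step₁
    D₁⊆S : D₁ ⊆ S
    D₁⊆S = proj₁ (proj₂ step₁)
    fused₁ = proj₂ (proj₂ (proj₂ step₁))

    P₂ : ℕ → List ℕ → InfSet → Set
    P₂ d u S′ = Below u (suc d) → Rejects u D₁ → ∀ x → x ∈ S′ → x ∈ D₁ → d < x → Rejects (x ∷ u) D₁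

    tail-Accepts : ∀ {u x S′} → Accepts (x ∷ u) S′ → (∀ {y} → y ∈ D₁ → x < y → y ∈ S′) →
                   Accepts (x ∷ u) D₁
    tail-Accepts {u} a D₁⊆ b (branch eq h) = a b (branch eq λ r r> →
      D₁⊆ (h r r>) (subst (_< enum b r) (∷-injectiveˡ eq) (enum-mono-< b r>)))

    -- If infinitely many one-point extensions of u were accepted, their end points would form
    -- a set accepting u.
    P₂-dense : ∀ d u → Dense (P₂ d u)
    P₂-dense d u S′ with em? (Below u (suc d) × Rejects u D₁)
    ... | no  ¬h = S′ , ⊆-refl , λ u< rej → ⊥-elim (¬h (u< , rej))
    ... | yes (u< , rej) with em? (Unbounded λ x → x ∈ D₁ × d < x × ¬ Rejects (x ∷ u) D₁)
    ... | no  ¬unb with ¬unbounded ¬unb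
    ... | n , bnd with above n S′
    ... | S″ , S″⊆ , n<S″ = S″ , S″⊆ , λ _ _ x x∈ x∈D₁ d<x → ¬¬-elim λ ¬rej →
              bnd x (<⇒≤ (n<S″ x∈)) (x∈D₁ , d<x , ¬rej)
    P₂-dense d u S′ | yes (u< , rej) | yes unb with thin unb
    ... | T , T-acc = ⊥-elim (rej T (sub (proj₁ ∘ T-acc)) λ b b∈ →
            let x∈T = tail b∈ (length u) ≤-refl
                x∈D₁ , d<x , ¬rej = T-acc x∈T
                S″ , (dec , _) , D₁⊆ = fused₁ (enum b (length u)) (inj₂ x∈D₁)
                                         (enum b (length u) ∷ u) (≤-refl ∷ Below-mono d<x u<)
                b∈′ = subst (λ v → Branch (enum b (length u) ∷ v) (_∈ D₁) b) (stem b∈)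
                        (Branch-prefix b (suc (length u)) (n≤1+n _) (Branch-mono (proj₁ ∘ T-acc) b∈))
            in case dec of λ
               { (inj₁ a) → tail-Accepts {u} a D₁⊆ b b∈′
               -- Rejection by `S″` would pass to `D₁`: an accepting subset of `D₁`, cut above the
               -- end point, lies inside `S″`.
               ; (inj₂ r) → ⊥-elim (¬rej λ U U⊆ aU →
                   let V , V⊆ , V> = above (enum b (length u)) U in
                   r V (sub λ y∈ → D₁⊆ (mem U⊆ (mem V⊆ y∈)) (V> y∈))
                     λ b′ → aU b′ ∘ Branch-mono (mem V⊆)) })

    step₂ = fusion P₂ (λ d u S′⊆S h u< rej x x∈ → h u< rej x (mem S′⊆S x∈)) P₂-dense N D₁

    D₂ : InfSet
    D₂ = proj₁ step₂
    D₂⊆D₁ : D₂ ⊆ D₁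
    D₂⊆D₁ = proj₁ (proj₂ step₂)
    N<D₂ : ∀ {x} → x ∈ D₂ → N < x
    N<D₂ = proj₁ (proj₂ (proj₂ step₂))
    fused₂ = proj₂ (proj₂ (proj₂ step₂))

    rejects-stem : Rejects t D₁
    rejects-stem S″ S″⊆ a = ¬acc (S″ , ⊆-trans S″⊆ D₁⊆S , a)

    module _ (b : InfSet) (b∈ : Branch t (_∈ D₂) b) where

      rejects-prefix : ∀ j → Rejects (prefix (enum b) (j + length t)) D₁
      rejects-prefix zero = subst (λ u → Rejects u D₁) (sym (stem b∈)) rejects-stem
      -- The first element after the stem is handled at stage `N`, each later one at the stage of
      -- its predecessor in `b`.
      rejects-prefix (suc zero) =
        let x∈ = tail b∈ (length t) ≤-refl
            t< = subst (λ u → Below u (suc N)) (sym (stem b∈)) (Below-mono (n≤1+n _) t<N)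
            S′ , p , D₂⊆ = fused₂ N (inj₁ refl) _ t<
        in p t< (rejects-prefix 0) _ (D₂⊆ x∈ (N<D₂ x∈)) (mem D₂⊆D₁ x∈) (N<D₂ x∈)
      rejects-prefix (suc (suc j)) =
        let k  = j + length t
            d∈ = tail b∈ k (m≤n+m _ j)
            x∈ = tail b∈ (suc k) (m≤n⇒m≤1+n (m≤n+m _ j))
            u< = ≤-refl ∷ prefix-Below b k
            S′ , p , D₂⊆ = fused₂ (enum b k) (inj₂ d∈) _ u<
        in p u< (rejects-prefix (suc j)) _ (D₂⊆ x∈ (inc b k)) (mem D₂⊆D₁ x∈) (inc b k)

    avoids : ∀ b → Branch t (_∈ D₂) b → ¬ (∃ λ n → X n b)
    avoids b b∈ (n , xn) =
      -- The element at position `k` is at least `n`, so its stage of the first fusion has decided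
      -- `X n`. A positive decision would make a rejected prefix accepted.
      let k  = n + length t
          d∈ = mem D₂⊆D₁ (tail b∈ k (m≤n+m _ n))
          S′ , (_ , hom) , D₁⊆ = fused₁ (enum b k) (inj₂ d∈) _ (≤-refl ∷ prefix-Below b k)
          b∈′ = Branch-mono (λ (x∈ , d<x) → D₁⊆ (mem D₂⊆D₁ x∈) d<x) (Branch-suc b k (m≤n+m _ n) b∈)
      in case hom n (s≤s (≤-trans (m≤m+n n _) (k≤enum b k))) of λ
         { (inj₁ all) → rejects-prefix b b∈ (suc n) D₁ ⊆-refl
                          (tail-Accepts (λ b′ b′∈ → n , all b′ b′∈) D₁⊆)
         ; (inj₂ none) → none b b∈′ xn }

  Homogeneous-constant : ∀ {X t S} → (∀ b b′ → Branch t (_∈ S) b → Branch t (_∈ S) b′ → X b → X b′) →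
                         Homogeneous X t S
  Homogeneous-constant {X} {t} {S} const with em? (∃ λ b → Branch t (_∈ S) b × X b)
  ... | yes (b , b∈ , xb) = inj₁ λ b′ b′∈ → const b b′ b∈ b′∈ xb
  ... | no  ¬x            = inj₂ λ b b∈ xb → ¬x (b , b∈ , xb)

  -- Tuples coded by branches

  module Coding {n : ℕ} (lab : ℕ → Fin n) where

    Entry : InfSet → Fin n → ℕ → Set
    Entry b j x = ∃ λ r → enum b r ≡ x × lab r ≡ j

    code : InfSet → Tuple n
    code b (j , x) = does (em? (Entry b j x))

    code⁺ : ∀ {b j x} → Entry b j x → code b (j , x) ≡ true
    code⁺ {b} {j} {x} e with em? (Entry b j x)
    ... | yes _ = refl
    ... | no ¬e = ⊥-elim (¬e e)

    code⁻ : ∀ {b j x} → code b (j , x) ≡ true → Entry b j x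
    code⁻ {b} {j} {x} eq with em? (Entry b j x) | eq
    ... | yes e | _ = e
    ... | no _  | ()

    code-≡ : ∀ {b b′ j x} → (Entry b j x → Entry b′ j x) → (Entry b′ j x → Entry b j x) →
             code b (j , x) ≡ code b′ (j , x)
    code-≡ {b} {b′} {j} {x} f g with em? (Entry b j x) | em? (Entry b′ j x)
    ... | yes _ | yes _  = refl
    ... | no _  | no _   = refl
    ... | yes e | no ¬e  = ⊥-elim (¬e (f e))
    ... | no ¬e | yes e  = ⊥-elim (¬e (g e))

    entry-transfer : ∀ {t S x j} b b′ → (∀ {y} → y ∈ S → x < y) →
                     Branch t (_∈ S) b → Branch t (_∈ S) b′ → Entry b j x → Entry b′ j x
    entry-transfer {t} b b′ S> b∈ b′∈ (r , refl , eq) with length t ≤? r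
    ... | yes t≤r = ⊥-elim (<-irrefl refl (S> (tail b∈ r t≤r)))
    ... | no  t≰r = r , sym (prefix-≡ (length t) (trans (stem b∈) (sym (stem b′∈))) (≰⇒> t≰r)) , eq

    -- Galvin-Prikry by induction on Borel codes, pulled back along `code`. For a cylinder at `x`,
    -- the reservoir is cut above `x`, so that the stem alone settles the entry; complements
    -- exchange the two alternatives.
    Borel-Ramsey : (B : BorelCode (Fin n × ℕ)) → Ramsey (λ b → ⟦ B ⟧ (code b))
    Borel-Ramsey (cyl (j , x) v) t S with above x S
    ... | S′ , S′⊆S , S′> = S′ , S′⊆S , Homogeneous-constant λ b b′ b∈ b′∈ →
      trans (code-≡ {b′} {b} (entry-transfer b′ b S′> b′∈ b∈) (entry-transfer b b′ S′> b∈ b′∈))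
    Borel-Ramsey (compl B) t S with Borel-Ramsey B t S
    ... | S′ , S′⊆S , inj₁ h = S′ , S′⊆S , inj₂ λ b b∈ ¬x → ¬x (h b b∈)
    ... | S′ , S′⊆S , inj₂ h = S′ , S′⊆S , inj₁ h
    Borel-Ramsey (⋃ F) = Ramsey-⋃ (λ n b → ⟦ F n ⟧ (code b)) (Borel-Ramsey ∘ F)

  -- A sparse set along which the values of `β` are decided

  module _ {n : ℕ} (β : InfSet → Fin n → ℕ → Bool) where

    -- Branches run through a sparse set p₀ < p₁ < …, and stems T are lists of indices of p.
    -- val T is the pointwise limit of β along branches that leave T ever later; on the interval
    -- [qₗ , qₗ₊₁) around pₗ it equals β as soon as T contains all indices up to l.
    record Skeleton : Set where
      field
        p q     : InfSet
        val     : List ℕ → Fin n → ℕ → Bool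
        decided : ∀ {T l} → Below T (suc l) → ∀ κ → Branch T (l <_) κ →
                  ∀ i {x} → x < enum q (suc l) → β (p ∘ₛ κ) i x ≡ val T i x
        growth  : ∀ T i →
                  (∀ {k} → Below T (suc k) → ∀ x → enum q (suc k) ≤ x → val T i x ≡ false) ⊎
                  (∀ {k} → Below T (suc k) →
                     ∃ λ x → enum q k ≤ x × x < enum q (suc k) × val T i x ≡ true)

    limit : (∀ i x → Ramsey (λ b → β b i x ≡ true)) →
            Σ InfSet λ D → ∀ t i x → ∃ λ M → ∃ λ v →
              ∀ b → Branch t (λ y → y ∈ D × M < y) b → β b i x ≡ v
    limit ram = D , lim
      where
      P : ℕ → List ℕ → InfSet → Set
      P d t S = ∀ i x → x < suc d → Homogeneous (λ b → β b i x ≡ true) t S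

      fused : Fused P 0 (infSet id (λ _ → ≤-refl))
      fused = fusion P
        (λ d t S′⊆S h i x x< → Homogeneous-persistent _ t S′⊆S (h i x x<))
        (λ d t → all-Fin (λ i S′⊆S h x x< → Homogeneous-persistent _ t S′⊆S (h x x<))
                   λ i → all-< (suc d) (λ x → Homogeneous-persistent _ t) (λ x → ram i x t))
        0 (infSet id (λ _ → ≤-refl))

      D : InfSet
      D = proj₁ fused

      lim : ∀ t i x → ∃ λ M → ∃ λ v → ∀ b → Branch t (λ y → y ∈ D × M < y) b → β b i x ≡ v
      lim t i x with em? (∃ λ N → Below t N)
      ... | no  ¬t< = 0 , true , λ b b∈ → ⊥-elim (¬t< (_ , Branch-Below b∈))
      ... | yes (N , t<) =
        -- This stage is at least `N`, so it treats `t`, and at least `x`, so it decides the value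
        -- at `x`.
        let d = enum D (N ⊔ x)
            S′ , hom , D⊆ = proj₂ (proj₂ (proj₂ fused)) d (inj₂ (at (N ⊔ x))) t
                      (Below-mono (m≤n⇒m≤1+n (≤-trans (m≤m⊔n N x) (k≤enum D (N ⊔ x)))) t<)
        in case hom i x (s≤s (≤-trans (m≤n⊔m N x) (k≤enum D (N ⊔ x)))) of λ
           { (inj₁ h) → d , true , λ b b∈ → h b (Branch-mono (λ (y∈ , d<y) → D⊆ y∈ d<y) b∈)
           ; (inj₂ h) → d , false , λ b b∈ →
               ¬-not (h b (Branch-mono (λ (y∈ , d<y) → D⊆ y∈ d<y) b∈)) }

    module Sparse (D : InfSet) (M : List ℕ → Fin n → ℕ → ℕ) (v : List ℕ → Fin n → ℕ → Bool)
      (β-lim : ∀ t i x b → Branch t (λ y → y ∈ D × M t i x < y) b → β b i x ≡ v t i x) where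

      Unb : List ℕ → Fin n → Set
      Unb t i = Unbounded λ x → v t i x ≡ true

      -- Demands on a point `y` that may follow `N` in the sparse set: tails beyond `y` no longer
      -- affect values below `N`, a finite limit has ended before `y`, and an infinite one gains an
      -- element between `N` and `y`.
      Req : ℕ → List ℕ → Fin n → ℕ → Set
      Req N t i y = (∀ x → x < N → M t i x ≤ y) ×
                    (¬ Unb t i → ∀ x → y ≤ x → v t i x ≡ false) ×
                    (Unb t i → ∃ λ x → N ≤ x × x < y × v t i x ≡ true)

      Req-persistent : ∀ N t i → Up.Persistent (Req N t i)
      Req-persistent N t i y≤ (a , b , c) =
        (λ x x< → ≤-trans (a x x<) y≤) ,
        (λ ¬u x y≤x → b ¬u x (≤-trans y≤ y≤x)) ,
        (λ u → let x , N≤x , x<y , eq = c u in x , N≤x , ≤-trans x<y y≤ , eq)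

      Req-dense : ∀ N t i → Up.Dense (Req N t i)
      Req-dense N t i y with em? (Unb t i)
      ... | yes u = let x , N≤x , eq = u N
                        y′ , y≤ , h = Up.all-< N (λ x y≤ M≤ → ≤-trans M≤ y≤)
                                        (λ x c → c ⊔ M t i x , m≤m⊔n c _ , m≤n⊔m c _) (y ⊔ suc x)
                    in y′ , ≤-trans (m≤m⊔n y (suc x)) y≤ , h , (λ ¬u → ⊥-elim (¬u u)) ,
                       λ _ → x , N≤x , ≤-trans (m≤n⊔m y (suc x)) y≤ , eq
      ... | no ¬u = let z , hz = ¬unbounded ¬u
                        y′ , y≤ , h = Up.all-< N (λ x y≤ M≤ → ≤-trans M≤ y≤)
                                        (λ x c → c ⊔ M t i x , m≤m⊔n c _ , m≤n⊔m c _) (y ⊔ z)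
                    in y′ , ≤-trans (m≤m⊔n y z) y≤ , h ,
                       (λ _ x y′≤x → ¬-not (hz x (≤-trans (≤-trans (m≤n⊔m y z) y≤) y′≤x))) ,
                       λ u → ⊥-elim (¬u u)

      abstract
        bound : ∀ N → ∃ λ y → ∀ t → Below t N → ∀ i → Req N t i y
        bound N =
          let y , _ , h = Up.all-Below N (λ t y≤ h i → Req-persistent N t i y≤ (h i))
                            (λ t → Up.all-Fin (Req-persistent N t) (Req-dense N t)) 0
          in y , h

      g : ℕ → ℕ
      g d = proj₁ (bound (suc d))

      abstract
        sparse : Σ InfSet λ e → (∀ {x} → x ∈ e → x ∈ D) × (∀ k → g (enum e k) < enum e (suc k))
        sparse = thinBy g (∈-unbounded D)

      e : InfSet
      e = proj₁ sparse

      req : ∀ k t → Below t (suc (enum e k)) → ∀ i → Req (suc (enum e k)) t i (enum e (suc k))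
      req k t t< i = Req-persistent _ t i (<⇒≤ (proj₂ (proj₂ sparse) k))
                       (proj₂ (bound (suc (enum e k))) t t< i)

      -- The points of `e` go alternately to `q` and `p`, so that `q₀ < p₀ < q₁ < p₁ < …`. The
      -- recursion makes `dbl (suc k)` reduce to two successors.
      dbl : ℕ → ℕ
      dbl zero    = zero
      dbl (suc k) = suc (suc (dbl k))

      p q : InfSet
      p = infSet (enum e ∘ suc ∘ dbl) (λ k → <-trans (inc e _) (inc e _))
      q = infSet (enum e ∘ dbl) (λ k → <-trans (inc e _) (inc e _))

      p[_] : List ℕ → List ℕ
      p[_] = map (enum p)

      Below-map : ∀ {T k} → Below T k → Below p[ T ] (enum p k)
      Below-map []        = []
      Below-map (x< ∷ T<) = enum-mono-< p x< ∷ Below-map T<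

      Below-map-suc : ∀ {T k} → Below T (suc k) → Below p[ T ] (suc (enum p k))
      Below-map-suc []              = []
      Below-map-suc (s≤s x≤k ∷ T<) = s≤s (enum-mono-≤ p x≤k) ∷ Below-map T<

      val : List ℕ → Fin n → ℕ → Bool
      val T = v p[ T ]

      prefix-∘ : ∀ κ T → prefix (enum κ) (length T) ≡ T →
                 prefix (enum (p ∘ₛ κ)) (length p[ T ]) ≡ p[ T ]
      prefix-∘ κ T eq = trans (go T) (cong p[_] eq)
        where
        go : ∀ T → prefix (enum (p ∘ₛ κ)) (length p[ T ]) ≡ p[ prefix (enum κ) (length T) ]
        go []      = refl
        go (x ∷ T) = cong₂ _∷_ (cong (enum (p ∘ₛ κ)) (length-map (enum p) T)) (go T)

      decided : ∀ {T l} → Below T (suc l) → ∀ κ → Branch T (l <_) κ →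
                ∀ i {x} → x < enum q (suc l) → β (p ∘ₛ κ) i x ≡ val T i x
      decided {T} {l} T< κ κ∈ i {x} x< = β-lim p[ T ] i x (p ∘ₛ κ)
        (branch (prefix-∘ κ T (stem κ∈)) λ r T≤r →
           proj₁ (proj₂ sparse) (at _) ,
           -- The tail starts no earlier than `enum p (suc l)`, the successor of `enum q (suc l)` in
           -- `e`, and hence lies beyond the bound that settles all values up to `enum q (suc l)`.
           ≤-<-trans (proj₁ (proj₂ (bound (suc (enum q (suc l)))) p[ T ] T<′ i) x (m≤n⇒m≤1+n x<))
             (<-≤-trans (proj₂ (proj₂ sparse) (dbl (suc l)))
                (enum-mono-≤ p (tail κ∈ r (subst (_≤ r) (length-map (enum p) T) T≤r)))))
        where
        T<′ : Below p[ T ] (suc (enum q (suc l)))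
        T<′ = Below-mono (s≤s (<⇒≤ (inc e (suc (dbl l))))) (Below-map-suc T<)

      growth : ∀ T i →
               (∀ {k} → Below T (suc k) → ∀ x → enum q (suc k) ≤ x → val T i x ≡ false) ⊎
               (∀ {k} → Below T (suc k) →
                  ∃ λ x → enum q k ≤ x × x < enum q (suc k) × val T i x ≡ true)
      growth T i with em? (Unb p[ T ] i)
      ... | no ¬u = inj₁ λ {k} T< →
        proj₁ (proj₂ (req (suc (dbl k)) p[ T ] (Below-map-suc T<) i)) ¬u
      ... | yes u = inj₂ λ {k} T< →
        let x , ≤x , x< , eq = proj₂ (proj₂ (req (suc (dbl k)) p[ T ] (Below-map-suc T<) i)) u
        in x , ≤-trans (<⇒≤ (inc e (dbl k))) (<⇒≤ ≤x) , x< , eq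

      result : Skeleton
      result = record
        { p = p ; q = q ; val = val ; decided = decided ; growth = growth }

    abstract
      skeleton : (∀ i x → Ramsey (λ b → β b i x ≡ true)) → Skeleton
      skeleton ram = Sparse.result (proj₁ (limit ram)) (λ t i x → proj₁ (proj₂ (limit ram) t i x))
        (λ t i x → proj₁ (proj₂ (proj₂ (limit ram) t i x)))
        (λ t i x → proj₂ (proj₂ (proj₂ (limit ram) t i x)))

  -- Extensions of finite stems and generic branches

  prefix-cong : ∀ {f g} k → (∀ {x} → x < k → f x ≡ g x) → prefix f k ≡ prefix g k
  prefix-cong zero    h = refl
  prefix-cong (suc k) h = cong₂ _∷_ (h ≤-refl) (prefix-cong k (h ∘ m≤n⇒m≤1+n))

  Decreasing : List ℕ → Set
  Decreasing T = ∃ λ N → Below T N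

  -- Positions are counted from the end of the list; junk value 0 beyond the length.
  nth : List ℕ → ℕ → ℕ
  nth []      x = 0
  nth (y ∷ t) x with x ≟ length t
  ... | yes _ = y
  ... | no  _ = nth t x

  nth-head : ∀ y t → nth (y ∷ t) (length t) ≡ y
  nth-head y t with length t ≟ length t
  ... | yes _ = refl
  ... | no  h = ⊥-elim (h refl)

  nth-tail : ∀ y t {x} → x < length t → nth (y ∷ t) x ≡ nth t x
  nth-tail y t {x} x< with x ≟ length t
  ... | yes refl = ⊥-elim (<-irrefl refl x<)
  ... | no  _    = refl

  prefix-nth : ∀ T → prefix (nth T) (length T) ≡ T
  prefix-nth []      = refl
  prefix-nth (y ∷ t) = cong₂ _∷_ (nth-head y t)
    (trans (prefix-cong (length t) (nth-tail y t)) (prefix-nth t))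

  nth-< : ∀ {T N x} → Below T N → x < length T → nth T x < N
  nth-< {y ∷ t} {x = x} (y<N ∷ t<) (s≤s x≤) with x ≟ length t
  ... | yes _  = y<N
  ... | no  x≢ = <-trans (nth-< t< (≤∧≢⇒< x≤ x≢)) y<N

  nth-inc : ∀ {T N x} → Below T N → suc x < length T → nth T x < nth T (suc x)
  nth-inc {y ∷ t} {x = x} (_ ∷ t<) (s≤s x<) with m≤n⇒m<n∨m≡n x<
  ... | inj₁ sx< = subst₂ _<_ (sym (nth-tail y t x<)) (sym (nth-tail y t sx<)) (nth-inc t< sx<)
  ... | inj₂ eq  = subst₂ _<_ (sym (nth-tail y t x<))
                     (sym (trans (cong (nth (y ∷ t)) eq) (nth-head y t))) (nth-< t< x<)

  module Extension {n : ℕ} (lab : ℕ → Fin n) where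

    -- A new element occupies position `length T′`, so its label is fixed before it is chosen and
    -- selects the constraint it must obey.
    data Ext (Q : Fin n → ℕ → Set) (T : List ℕ) : List ℕ → Set where
      stop : Ext Q T T
      step : ∀ {T′ k} → Ext Q T T′ → Below T′ k → Q (lab (length T′)) k → Ext Q T (k ∷ T′)

    Ext-trans : ∀ {Q T T′ T″} → Ext Q T T′ → Ext Q T′ T″ → Ext Q T T″
    Ext-trans e stop            = e
    Ext-trans e (step e′ T< kQ) = step (Ext-trans e e′) T< kQ

    Ext-mono : ∀ {Q Q′ T T′} → (∀ j {k} → Q j k → Q′ j k) → Ext Q T T′ → Ext Q′ T T′
    Ext-mono Q⊆ stop           = stop
    Ext-mono Q⊆ (step e T< kQ) = step (Ext-mono Q⊆ e) T< (Q⊆ _ kQ)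

    Ext-Below : ∀ {Q T T′ k} → Ext Q T T′ → Below T′ k → Below T k
    Ext-Below stop         T<         = T<
    Ext-Below (step e _ _) (k< ∷ T<) = Ext-Below e (Below-mono (<⇒≤ k<) T<)

    Ext-length : ∀ {Q T T′} → Ext Q T T′ → length T ≤ length T′
    Ext-length stop         = ≤-refl
    Ext-length (step e _ _) = m≤n⇒m≤1+n (Ext-length e)

    Ext-decreasing : ∀ {Q T T′} → Ext Q T T′ → Decreasing T → Decreasing T′
    Ext-decreasing stop          d = d
    Ext-decreasing (step e T< _) d = _ , ≤-refl ∷ T<

    Ext-stem : ∀ {Q T T′ f} → Ext Q T T′ → prefix f (length T′) ≡ T′ → prefix f (length T) ≡ T
    Ext-stem stop         eq = eq
    Ext-stem (step e _ _) eq = Ext-stem e (∷-injectiveʳ eq)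

    nth-Ext : ∀ {Q T T′ x} → Ext Q T T′ → x < length T → nth T′ x ≡ nth T x
    nth-Ext stop                      x< = refl
    nth-Ext (step {T′ = T′} e _ _) x< =
      trans (nth-tail _ T′ (<-≤-trans x< (Ext-length e))) (nth-Ext e x<)

    nth-member : ∀ {Q T T′ x} → Ext Q T T′ → length T ≤ x → x < length T′ → Q (lab x) (nth T′ x)
    nth-member stop T≤x x< = ⊥-elim (<⇒≱ x< T≤x)
    nth-member {x = x} (step {T′ = T′} e _ kQ) T≤x (s≤s x≤) with x ≟ length T′
    ... | yes refl = kQ
    ... | no  x≢   = nth-member e T≤x (≤∧≢⇒< x≤ x≢)

    -- A Rasiowa-Sikorski construction: the goals are met along a chain of stems, and the strict
    -- growth in length makes the union of the chain infinite.
    generic : ∀ Q T → Decreasing T → (Goal : ℕ → List ℕ → Set) →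
              (∀ r T′ → Ext Q T T′ →
                 ∃ λ T″ → Ext Q T′ T″ × length T′ < length T″ × Goal r T″) →
              Σ InfSet λ κ → prefix (enum κ) (length T) ≡ T ×
                (∀ r → length T ≤ r → Q (lab r) (enum κ r)) ×
                (∀ r → ∃ λ T′ → prefix (enum κ) (length T′) ≡ T′ × Goal r T′)
    generic Q T dec Goal next = κ , stem-at 0 , member , λ r →
      chain (suc r) , stem-at (suc r) , proj₂ (proj₂ (proj₂ (next r (chain r) (chain-Ext r))))
      where
      state : ℕ → Σ (List ℕ) (Ext Q T)
      state zero    = T , stop
      state (suc r) = let T′ , e = state r
                          T″ , e′ , _ = next r T′ e
                      in T″ , Ext-trans e e′

      chain : ℕ → List ℕ
      chain r = proj₁ (state r)
      chain-Ext : ∀ r → Ext Q T (chain r)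
      chain-Ext r = proj₂ (state r)

      chain-mono : ∀ {r s} → r ≤ s → Ext Q (chain r) (chain s)
      chain-mono {s = zero}  z≤n = stop
      chain-mono {r} {suc s} r≤s with m≤n⇒m<n∨m≡n r≤s
      ... | inj₂ refl       = stop
      ... | inj₁ (s≤s r≤s′) =
        Ext-trans (chain-mono r≤s′) (proj₁ (proj₂ (next s (chain s) (chain-Ext s))))

      r≤length : ∀ r → r ≤ length (chain r)
      r≤length zero    = z≤n
      r≤length (suc r) =
        ≤-<-trans (r≤length r) (proj₁ (proj₂ (proj₂ (next r (chain r) (chain-Ext r)))))

      κ-fun : ℕ → ℕ
      -- The stem `chain (suc x)` is longer than `x`, so it has settled position `x`.
      κ-fun x = nth (chain (suc x)) x

      κ-nth : ∀ r {x} → x < length (chain r) → κ-fun x ≡ nth (chain r) x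
      κ-nth r {x} x< with ≤-total r (suc x)
      ... | inj₁ r≤ = nth-Ext (chain-mono r≤) x<
      ... | inj₂ ≤r = sym (nth-Ext (chain-mono ≤r) (r≤length (suc x)))

      κ : InfSet
      κ = infSet κ-fun λ x →
        subst₂ _<_ (sym (κ-nth (suc (suc x)) (≤-trans (n≤1+n _) (r≤length (suc (suc x)))))) refl
          (nth-inc (proj₂ (Ext-decreasing (chain-Ext (suc (suc x))) dec)) (r≤length (suc (suc x))))

      stem-at : ∀ r → prefix (enum κ) (length (chain r)) ≡ chain r
      stem-at r = trans (prefix-cong (length (chain r)) (κ-nth r)) (prefix-nth (chain r))

      member : ∀ r → length T ≤ r → Q (lab r) (enum κ r)
      member r T≤r = nth-member (chain-Ext (suc r)) T≤r (r≤length (suc r))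

    Ext-prefix : ∀ {Q T} κ → prefix (enum κ) (length T) ≡ T →
                 (∀ r → length T ≤ r → Q (lab r) (enum κ r)) →
                 ∀ r → length T ≤ r → Ext Q T (prefix (enum κ) r)
    Ext-prefix {Q} {T} κ eq mem-κ r T≤r =
      subst (Ext Q T ∘ prefix (enum κ)) (m∸n+n≡m T≤r) (go (r ∸ length T))
      where
      go : ∀ d → Ext Q T (prefix (enum κ) (d + length T))
      go zero    = subst (Ext Q T) (sym eq) stop
      go (suc d) = step (go d) (prefix-Below κ _)
        (subst (λ l → Q (lab l) (enum κ (d + length T))) (sym (length-prefix (enum κ) _))
           (mem-κ _ (m≤n+m _ d)))

    one-more : ∀ (E : Fin n → InfSet) T M → Decreasing T →
               ∃ λ k → M ≤ k × Below T k × k ∈ E (lab (length T))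
    one-more E T M (N , T<) =
      let k , ≤k , k∈ = ∈-unbounded (E (lab (length T))) (M ⊔ N)
      in k , ≤-trans (m≤m⊔n M N) ≤k , Below-mono (≤-trans (m≤n⊔m M N) ≤k) T< , k∈

  -- The alternating colouring and the set defeating it

  module Game {n n′ : ℕ} (lab : ℕ → Fin n′) (β : InfSet → Fin n → ℕ → Bool)
              (β-inf : ∀ b i → Infinite (β b i)) (sk : Skeleton β) where
    open Coding lab
    open Extension lab
    open Skeleton sk

    -- A `full` stem counts for every label, since its limit already meets all later intervals. A
    -- `hit` is credited to the label of the newest index `k`, in whose own interval the element `x`
    -- lies.
    data Event (i : Fin n) (j : Fin n′) : List ℕ → Set where
      full : ∀ {T} → (∀ {k} → Below T (suc k) →
                        ∃ λ x → enum q k ≤ x × x < enum q (suc k) × val T i x ≡ true) →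
             Event i j T
      hit  : ∀ {k T x} → lab (length T) ≡ j → enum q k ≤ x → x < enum q (suc k) →
             val (k ∷ T) i x ≡ true → Event i j (k ∷ T)

    -- A Mathias-type condition with one reservoir per label.
    record Cond : Set where
      constructor cond
      field
        root       : List ℕ
        sets       : Fin n′ → InfSet
        decreasing : Decreasing root
      allowed : Fin n′ → ℕ → Set
      allowed j k = k ∈ sets j
    open Cond

    record _≼_ (c′ c : Cond) : Set where
      constructor below
      field
        ext    : Ext (allowed c) (root c) (root c′)
        shrink : ∀ j → sets c′ j ⊆ sets c j
    open _≼_

    ≼-trans : ∀ {a b c} → a ≼ b → b ≼ c → a ≼ c
    ≼-trans (below e s) (below e′ s′) =
      below (Ext-trans e′ (Ext-mono (λ j → mem (s′ j)) e)) λ j → ⊆-trans (s j) (s′ j)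

    module Conds = Density _≼_ (below stop λ j → ⊆-refl) ≼-trans

    -- In forcing terms, `Dead` conditions exclude further events, and below an `Alive` condition
    -- every stronger one still admits an extension with an event.
    Dead Alive : Fin n → Fin n′ → Cond → Set
    Dead i j c  = ∀ {T k} → Ext (allowed c) (root c) T → Below T k → allowed c (lab (length T)) k →
                  ¬ Event i j (k ∷ T)
    Alive i j c = ∀ c′ → c′ ≼ c → ¬ Dead i j c′

    Dead-persistent : ∀ i j → Conds.Persistent (Dead i j)
    Dead-persistent i j c′≼c dead e T< k∈ =
      dead (Ext-trans (ext c′≼c) (Ext-mono (λ j → mem (shrink c′≼c j)) e)) T<
           (mem (shrink c′≼c _) k∈)

    decide : Conds.Dense (λ c → ∀ i j → Dead i j c ⊎ Alive i j c)
    decide = Conds.all-Fin (λ i c′≼c h j → per i j c′≼c (h j))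
      λ i → Conds.all-Fin (per i) λ j c → den i j c
      where
      per : ∀ i j → Conds.Persistent (λ c → Dead i j c ⊎ Alive i j c)
      per i j c′≼c (inj₁ d) = inj₁ (Dead-persistent i j c′≼c d)
      per i j c′≼c (inj₂ a) = inj₂ λ c″ c″≼c′ → a c″ (≼-trans c″≼c′ c′≼c)
      den : ∀ i j → Conds.Dense (λ c → Dead i j c ⊎ Alive i j c)
      den i j c with em? (∃ λ c′ → c′ ≼ c × Dead i j c′)
      ... | yes (c′ , c′≼c , d) = c′ , c′≼c , inj₁ d
      ... | no  ¬d              = c , below stop (λ j → ⊆-refl) ,
        inj₂ λ c′ c′≼c d → ¬d (c′ , c′≼c , d)

    -- Without events, β b i would be finite along every branch b through c.
    ¬all-Dead : ∀ i c → ¬ (∀ j → Dead i j c)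
    ¬all-Dead i c dead =
      let κ , κ-root , κ∈ , _ = generic (allowed c) (root c) (decreasing c) (λ _ _ → ⊤) λ r T e →
            let k , _ , T< , k∈ = one-more (sets c) T 0 (Ext-decreasing e (decreasing c))
            in k ∷ T , step stop T< k∈ , ≤-refl , tt
          R = length (root c)
          -- Here `l` is the index of the interval around `x`, and position `r` holds the last
          -- element of `κ` not exceeding `l`; the stem through it already decides the value at `x`.
          x , q≤x , βx = β-inf (p ∘ₛ κ) i (enum q (enum κ R))
          l , κR≤l , ql≤x , x<q = locate q q≤x
          r , R≤r , κr≤l , l<κ = locate κ κR≤l
          T  = prefix (enum κ) r
          T< = prefix-Below κ r
          no-event = λ j → dead j (Ext-prefix κ κ-root κ∈ r R≤r) T<
                       (subst (λ s → allowed c (lab s) (enum κ r)) (sym (length-prefix (enum κ) r))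
                          (κ∈ r R≤r))
          val-x : val (enum κ r ∷ T) i x ≡ true
          val-x = trans (sym (decided (s≤s κr≤l ∷ T<) κ
            (branch (cong (prefix (enum κ)) (length-prefix (enum κ) (suc r))) λ s r<s →
               <-≤-trans l<κ (enum-mono-≤ κ (subst (_≤ s) (length-prefix (enum κ) (suc r)) r<s)))
            i x<q)) βx
      in case growth (enum κ r ∷ T) i of λ
         { (inj₂ f) → no-event (lab r) (full f)
         -- The limit vanishes beyond the interval of the last stem index, so `x` must lie in that
         -- very interval.
         ; (inj₁ f) → case m≤n⇒m<n∨m≡n κr≤l of λ
             { (inj₁ κr<l) → case trans (sym val-x)
                                (f (≤-refl ∷ T<) x (≤-trans (enum-mono-≤ q κr<l) ql≤x)) of λ ()
             ; (inj₂ κr≡l) → no-event (lab r) (hit (cong lab (length-prefix (enum κ) r))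
                 (subst (λ s → enum q s ≤ x) (sym κr≡l) ql≤x)
                 (subst (λ s → x < enum q (suc s)) (sym κr≡l) x<q) val-x) } }

    abstract
      assignment : ∃ λ c → ∀ i → ∃ λ j → Alive i j c
      assignment with decide (cond [] (λ _ → infSet id λ _ → ≤-refl) (0 , []))
      ... | c , _ , dec = c , λ i → ¬¬-elim λ ¬alive → ¬all-Dead i c λ j →
        [ (λ d → d) , (λ a → ⊥-elim (¬alive (j , a))) ]′ (dec i j)

    a : Fin n → Fin n′
    a i = proj₁ (proj₂ assignment i)

    c⋆ : Cond
    c⋆ = proj₁ assignment

    a-Alive : ∀ i → Alive i (a i) c⋆
    a-Alive i = proj₂ (proj₂ assignment i)

    abstract
      window : ∀ N → ∃ λ K → N ≤ K × (∀ j → ∃ λ k → N ≤ k × k < K × k ∈ sets c⋆ j)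
      window N = Up.all-Fin
        (λ j K≤ (k , N≤k , k<K , k∈) → k , N≤k , <-≤-trans k<K K≤ , k∈)
        (λ j K → let k , N≤k , k∈ = ∈-unbounded (sets c⋆ j) N
                 in K ⊔ suc k , m≤m⊔n K _ , k , N≤k , m≤n⊔m K _ , k∈) N

    spaced : Σ InfSet λ S → (∀ {x} → x ∈ S → ⊤) ×
             (∀ r → proj₁ (window (enum S r)) < enum S (suc r))
    spaced = thinBy (λ N → proj₁ (window N)) λ N → N , ≤-refl , tt

    y Y : InfSet
    y = proj₁ spaced
    Y = q ∘ₛ y

    block : Bool → ℕ → ℕ
    block true  r = 2 * r
    block false r = suc (2 * r)

    r≤block : ∀ v r → r ≤ block v r
    r≤block true  r = m≤m+n r _
    r≤block false r = m≤n⇒m≤1+n (m≤m+n r _)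

    even-block : ℕ → Set
    even-block x = ∃ λ r → enum Y (2 * r) ≤ x × x < enum Y (suc (2 * r))

    -- The colouring alternates between consecutive blocks [Yᵣ , Yᵣ₊₁), so every set of the
    -- condition c⋆ contains infinitely many indices k with [qₖ , qₖ₊₁) in blocks of either colour.
    colour : Cantor
    colour x = does (em? (even-block x))

    colour-block : ∀ v r {x} → enum Y (block v r) ≤ x → x < enum Y (suc (block v r)) → colour x ≡ v
    colour-block true r {x} ≤x x< with em? (even-block x)
    ... | yes _ = refl
    ... | no ¬e = ⊥-elim (¬e (r , ≤x , x<))
    colour-block false r {x} ≤x x< with em? (even-block x)
    ... | no _ = refl
    ... | yes (s , ≤x′ , x<′) = ⊥-elim (even≢odd s r (≤-antisym
            (s≤s⁻¹ (enum-cancel-< Y {2 * s} (≤-<-trans ≤x′ x<)))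
            (s≤s⁻¹ (enum-cancel-< Y {suc (2 * r)} (≤-<-trans ≤x x<′)))))

    Coloured : Bool → ℕ → Set
    Coloured v k = ∃ λ r → enum y (block v r) ≤ k × k < enum y (suc (block v r))

    coloured-interval : ∀ {v k x} → Coloured v k → enum q k ≤ x → x < enum q (suc k) → colour x ≡ v
    coloured-interval {v} (r , ≤k , k<) q≤x x<q = colour-block v r
      (≤-trans (enum-mono-≤ q ≤k) q≤x) (<-≤-trans x<q (enum-mono-≤ q k<))

    Coloured-unbounded : ∀ v j → Unbounded (λ k → k ∈ sets c⋆ j × Coloured v k)
    Coloured-unbounded v j N =
      let r = block v N
          k , ≤k , k< , k∈ = proj₂ (proj₂ (window (enum y r))) j
      in k , ≤-trans (r≤block v N) (≤-trans (k≤enum y r) ≤k) , k∈ ,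
         N , ≤k , <-trans k< (proj₂ (proj₂ spaced) r)

    -- `d` plays the role of `ψ(c)`, and `J` is the set of labels at which it is allowed to split.
    module Adversary (d : Cantor) (J : Fin n′ → Set) where

      constant : ∀ j → ∃ λ w → Unbounded (λ k → k ∈ sets c⋆ j × d (enum p k) ≡ w)
      constant j with em? (Unbounded (λ k → k ∈ sets c⋆ j × d (enum p k) ≡ true))
      ... | yes u = true , u
      ... | no ¬u = false , λ N →
        let M , h = ¬unbounded ¬u
            k , ≤k , k∈ = ∈-unbounded (sets c⋆ j) (M ⊔ N)
        in k , ≤-trans (m≤n⊔m M N) ≤k , k∈ , ¬-not λ eq → h k (≤-trans (m≤m⊔n M N) ≤k) (k∈ , eq)

      w : Fin n′ → Bool
      w j = proj₁ (constant j)

      -- The constraint obeyed along the whole branch. The sets `F v` are stricter and depend on the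
      -- colour being forced; both `F true` and `F false` stay within `Loose`, so the branch can
      -- alternate between them.
      Loose : Fin n′ → ℕ → Set
      Loose j k = k ∈ sets c⋆ j × (¬ J j → d (enum p k) ≡ w j)

      thinned : ∀ v j → Σ InfSet λ S → ∀ {k} → k ∈ S →
                k ∈ sets c⋆ j × (J j → Coloured v k) × (¬ J j → d (enum p k) ≡ w j)
      thinned v j with em? (J j)
      ... | yes j∈ = let S , h = thin (Coloured-unbounded v j) in
                     S , λ k∈ → proj₁ (h k∈) , (λ _ → proj₂ (h k∈)) , λ j∉ → ⊥-elim (j∉ j∈)
      ... | no  j∉ = let S , h = thin (proj₂ (constant j)) in
                     S , λ k∈ → proj₁ (h k∈) , (λ j∈ → ⊥-elim (j∉ j∈)) , λ _ → proj₂ (h k∈)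

      F : Bool → Fin n′ → InfSet
      F v j = proj₁ (thinned v j)

      F-Loose : ∀ v j {k} → k ∈ F v j → Loose j k
      F-Loose v j k∈ = let k∈′ , _ , dk = proj₂ (thinned v j) k∈ in k∈′ , dk

      Forced : Fin n → Bool → ℕ → List ℕ → Set
      Forced i v M T = ∃ λ x → M ≤ x × colour x ≡ v ×
        (∀ κ → prefix (enum κ) (length T) ≡ T → β (p ∘ₛ κ) i x ≡ true)

      Forced-Ext : ∀ {Q i v M T T′} → Ext Q T T′ → Forced i v M T → Forced i v M T′
      Forced-Ext e (x , M≤x , cx , f) = x , M≤x , cx , λ κ eq → f κ (Ext-stem e eq)

      Reachable : List ℕ → Set
      Reachable = Ext Loose (root c⋆)

      Reachable-decreasing : ∀ {T} → Reachable T → Decreasing T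
      Reachable-decreasing e = Ext-decreasing e (decreasing c⋆)

      -- Restricting the reservoirs to `F v` strengthens `c⋆`, so liveness of `a i` provides an
      -- event. A hit has its label in `J` and hence an index of colour `v`; a full stem meets every
      -- later interval, in particular one of colour `v`.
      force : ∀ i → J (a i) → ∀ v M T → Reachable T → ∃ λ T′ → Ext Loose T T′ × Forced i v M T′
      -- A first element `k₀ ≥ M` pushes the index of the event, and with it `x`, beyond `M`.
      force i ai∈J v M T e with one-more (F v) T M (Reachable-decreasing e)
      ... | k₀ , M≤k₀ , T<k₀ , k₀∈ = done
        where
        e₀ : Ext Loose T (k₀ ∷ T)
        e₀ = step stop T<k₀ (F-Loose v _ k₀∈)
        c₀ : Cond
        c₀ = cond (k₀ ∷ T) (F v) (_ , ≤-refl ∷ T<k₀)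
        c₀≼c⋆ : c₀ ≼ c⋆
        c₀≼c⋆ = below (Ext-mono (λ j → proj₁) (Ext-trans e e₀)) λ j → sub (proj₁ ∘ F-Loose v j)

        done : ∃ λ T′ → Ext Loose T T′ × Forced i v M T′
        done = ¬¬-elim λ ¬done → a-Alive i c₀ c₀≼c⋆
          λ {T₁} {k} e₁ T₁<k k∈ ev → ¬done (reach e₁ T₁<k k∈ ev)
          where
          reach : ∀ {T₁ k} → Ext (allowed c₀) (k₀ ∷ T) T₁ → Below T₁ k → k ∈ F v (lab (length T₁)) →
                  Event i (a i) (k ∷ T₁) → ∃ λ T′ → Ext Loose T T′ × Forced i v M T′
          reach {T₁} {k} e₁ T₁<k k∈ ev = by ev
            where
            e₂ : Ext Loose T (k ∷ T₁)
            e₂ = Ext-trans e₀ (Ext-mono (F-Loose v) (step e₁ T₁<k k∈))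
            M≤k : M ≤ k
            M≤k with Ext-Below e₁ T₁<k
            ... | k₀<k ∷ _ = ≤-trans M≤k₀ (<⇒≤ k₀<k)

            by : Event i (a i) (k ∷ T₁) → ∃ λ T′ → Ext Loose T T′ × Forced i v M T′
            by (hit {x = x} lab≡ q≤x x<q val-x) = k ∷ T₁ , e₂ , x ,
              ≤-trans M≤k (≤-trans (k≤enum q k) q≤x) ,
              coloured-interval
                (proj₁ (proj₂ (proj₂ (thinned v _) k∈)) (subst J (sym lab≡) ai∈J)) q≤x x<q ,
              λ κ eq → trans (decided (≤-refl ∷ T₁<k) κ (branch eq λ r r> →
                subst (_< enum κ r) (∷-injectiveˡ eq) (enum-mono-< κ r>)) i x<q) val-x
            -- The stem is full: leave a gap long enough to contain an interval of colour v.
            by (full f) = let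
                l = enum y (block v k)
                k≤l = ≤-trans (r≤block v k) (k≤enum y _)
                x , q≤x , x<q , val-x = f {l} (s≤s k≤l ∷ T₁<k)
                k₃ , l<k₃ , T₃< , k₃∈ = one-more (F v) (k ∷ T₁) (suc l) (_ , ≤-refl ∷ T₁<k)
              in k₃ ∷ k ∷ T₁ , Ext-trans e₂ (step stop T₃< (F-Loose v _ k₃∈)) , x ,
                 ≤-trans M≤k (≤-trans k≤l (≤-trans (k≤enum q l) q≤x)) ,
                 coloured-interval (k , ≤-refl , inc y (block v k)) q≤x x<q ,
                 λ κ eq → trans (decided (s≤s k≤l ∷ T₁<k) κ
                   (branch (∷-injectiveʳ eq) λ r r≥ →
                      <-≤-trans (subst (l <_) (sym (∷-injectiveˡ eq)) l<k₃)
                                (enum-mono-≤ κ r≥)) i x<q) val-x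

      _⊒_ : Σ (List ℕ) Reachable → Σ (List ℕ) Reachable → Set
      (T′ , _) ⊒ (T , _) = Ext Loose T T′

      module Stems = Density _⊒_ stop (λ e e′ → Ext-trans e′ e)

      force-all : ∀ M → Stems.Dense (λ (T , _) → ∀ i → J (a i) → ∀ v → Forced i v M T)
      force-all M = Stems.all-Fin (λ i e f ai∈J v → Forced-Ext e (f ai∈J v)) den
        where
        den : ∀ i → Stems.Dense (λ (T , _) → J (a i) → ∀ v → Forced i v M T)
        den i (T , e) with em? (J (a i))
        ... | no  ∉J   = (T , e) , stop , λ ∈J → ⊥-elim (∉J ∈J)
        ... | yes ai∈J =
          let T₁ , e₁ , f₁ = force i ai∈J true M T e
              T₂ , e₂ , f₂ = force i ai∈J false M T₁ (Ext-trans e e₁)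
          in (T₂ , Ext-trans e (Ext-trans e₁ e₂)) , Ext-trans e₁ e₂ ,
             λ { _ true → Forced-Ext e₂ f₁ ; _ false → f₂ }

      defeat : ∃ λ b → (∀ i → J (a i) → Splits colour (β b i)) ×
                       (∀ j → ¬ J j → ¬ Splits d (coord (code b) j))
      defeat =
        let κ , _ , κ∈ , goals = generic Loose (root c⋆) (decreasing c⋆)
              (λ r T → ∀ i → J (a i) → ∀ v → Forced i v r T) λ r T e →
              let (T₁ , e₁) , T⊑T₁ , f = force-all r (T , e)
                  -- One more element guarantees growth even when forcing leaves the stem unchanged;
                  -- the choice of `true` is arbitrary.
                  k , _ , T₁< , k∈ = one-more (F true) T₁ 0 (Reachable-decreasing e₁)
                  e₂ = step stop T₁< (F-Loose true _ k∈)
              in k ∷ T₁ , Ext-trans T⊑T₁ e₂ , s≤s (Ext-length T⊑T₁) ,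
                 λ i ai∈J v → Forced-Ext e₂ (f i ai∈J v)
        in p ∘ₛ κ , split κ goals , unsplit κ κ∈
        where
        split : ∀ κ → (∀ r → ∃ λ T → prefix (enum κ) (length T) ≡ T ×
                               (∀ i → J (a i) → ∀ v → Forced i v r T)) →
                ∀ i → J (a i) → Splits colour (β (p ∘ₛ κ) i)
        split κ goals i ai∈J = takes false , takes true
          where
          takes : ∀ v r → ∃ λ x → r ≤ x × β (p ∘ₛ κ) i x ≡ true × colour x ≡ v
          takes v r = let T , eq , f = goals r
                          x , r≤x , cx , βx = f i ai∈J v
                      in x , r≤x , βx κ eq , cx

        unsplit : ∀ κ → (∀ r → length (root c⋆) ≤ r → Loose (lab r) (enum κ r)) →
                  ∀ j → ¬ J j → ¬ Splits d (coord (code (p ∘ₛ κ)) j)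
        unsplit κ κ∈ j j∉J (zeros , ones) = clash (w j) refl
          where
          R = length (root c⋆)
          -- Only the finitely many elements from the root of `c⋆` escape the constraint `Loose`.
          late : ∀ {x} → enum (p ∘ₛ κ) R ≤ x → code (p ∘ₛ κ) (j , x) ≡ true → d x ≡ w j
          late {x} R≤x x∈ with code⁻ {p ∘ₛ κ} {j} {x} x∈
          ... | r , refl , refl = proj₂ (κ∈ r (≮⇒≥ λ r<R →
                  <⇒≱ (enum-mono-< (p ∘ₛ κ) r<R) R≤x)) j∉J
          clash : ∀ v → w j ≡ v → ⊥
          clash true  eq = let x , R≤x , x∈ , dx = zeros (enum (p ∘ₛ κ) R) in
                           case trans (sym (trans (late R≤x x∈) eq)) dx of λ ()
          clash false eq = let x , R≤x , x∈ , dx = ones (enum (p ∘ₛ κ) R) in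
                           case trans (sym (trans (late R≤x x∈) eq)) dx of λ ()

-- Covering many points by few fibres

module Counting {A : Set} where

  count : {P : A → Set} → Decidable P → List A → ℕ
  count P? xs = length (filter P? xs)

  count-∁ : {P : A → Set} (P? : Decidable P) (xs : List A) →
            count P? xs + count (¬? ∘ P?) xs ≡ length xs
  count-∁ P? []       = refl
  count-∁ P? (x ∷ xs) with P? x
  ... | yes _ = cong suc (count-∁ P? xs)
  ... | no  _ = trans (+-suc _ _) (cong suc (count-∁ P? xs))

  count-∪ : {P Q R : A → Set} (P? : Decidable P) (Q? : Decidable Q) (R? : Decidable R) →
            (∀ {x} → P x → R x) → (∀ {x} → Q x → R x) → ∀ xs →
            count P? xs + count Q? (filter (¬? ∘ P?) xs) ≤ count R? xs
  count-∪ P? Q? R? P⊆ Q⊆ []       = z≤n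
  count-∪ P? Q? R? P⊆ Q⊆ (x ∷ xs) with P? x | R? x
  ... | yes _ | yes _ = s≤s (count-∪ P? Q? R? P⊆ Q⊆ xs)
  ... | yes p | no ¬r = ⊥-elim (¬r (P⊆ p))
  ... | no _  | r? with Q? x | r?
  ... | yes _ | yes _ = ≤-trans (≤-reflexive (+-suc _ _)) (s≤s (count-∪ P? Q? R? P⊆ Q⊆ xs))
  ... | yes q | no ¬r = ⊥-elim (¬r (Q⊆ q))
  ... | no _  | yes _ = m≤n⇒m≤1+n (count-∪ P? Q? R? P⊆ Q⊆ xs)
  ... | no _  | no _  = count-∪ P? Q? R? P⊆ Q⊆ xs

  count-⊎ : {P Q R : A → Set} (P? : Decidable P) (Q? : Decidable Q) (R? : Decidable R) →
            (∀ {x} → R x → P x ⊎ Q x) → ∀ xs → count R? xs ≤ count P? xs + count Q? xs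
  count-⊎ P? Q? R? R⊆ []       = z≤n
  count-⊎ P? Q? R? R⊆ (x ∷ xs) with count-⊎ P? Q? R? R⊆ xs | R? x | P? x | Q? x
  ... | ih | no _  | no _  | no _  = ih
  ... | ih | no _  | no _  | yes _ = ≤-trans ih (+-monoʳ-≤ _ (n≤1+n _))
  ... | ih | no _  | yes _ | no _  = m≤n⇒m≤1+n ih
  ... | ih | no _  | yes _ | yes _ = m≤n⇒m≤1+n (≤-trans ih (+-monoʳ-≤ _ (n≤1+n _)))
  ... | ih | yes r | no ¬p | no ¬q = ⊥-elim ([ ¬p , ¬q ]′ (R⊆ r))
  ... | ih | yes _ | no _  | yes _ = ≤-trans (s≤s ih) (≤-reflexive (sym (+-suc _ _)))
  ... | ih | yes _ | yes _ | no _  = s≤s ih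
  ... | ih | yes _ | yes _ | yes _ = s≤s (≤-trans ih (+-monoʳ-≤ _ (n≤1+n _)))

  length≤fibres : ∀ {l} (f : A → Fin l) (xs : List A) k → (∀ y → count (λ x → f x ≟ᶠ y) xs ≤ k) →
                  ∀ j → j ≤ l → count (λ x → toℕ (f x) <? j) xs ≤ j * k
  length≤fibres f xs k h zero    _   =
    ≤-reflexive (cong length (filter-none (λ x → toℕ (f x) <? 0) (universal (λ _ ()) xs)))
  length≤fibres f xs k h (suc j) j<l = ≤-trans
    (count-⊎ (λ x → f x ≟ᶠ fromℕ< j<l) (λ x → toℕ (f x) <? j) (λ x → toℕ (f x) <? suc j)
       last-or-less xs)
    (+-mono-≤ (h (fromℕ< j<l)) (length≤fibres f xs k h j (<⇒≤ j<l)))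
    where
    last-or-less : ∀ {x} → toℕ (f x) < suc j → f x ≡ fromℕ< j<l ⊎ toℕ (f x) < j
    last-or-less (s≤s fx≤j) with m≤n⇒m<n∨m≡n fx≤j
    ... | inj₁ fx<j = inj₂ fx<j
    ... | inj₂ fx≡j = inj₁ (toℕ-injective (trans fx≡j (sym (toℕ-fromℕ< j<l))))

  large-fibre : ∀ {l} (f : A → Fin l) (xs : List A) k → l * k < length xs →
                ∃ λ y → k < count (λ x → f x ≟ᶠ y) xs
  large-fibre {l} f xs k lk< with any? (λ y → k <? count (λ x → f x ≟ᶠ y) xs)
  ... | yes y  = y
  ... | no  ¬y = ⊥-elim (<⇒≱ lk< (subst (_≤ l * k) all
                   (length≤fibres f xs k (λ y → ≮⇒≥ λ k< → ¬y (y , k<)) l ≤-refl)))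
    where
    all : count (λ x → toℕ (f x) <? l) xs ≡ length xs
    all = cong length (filter-all (λ x → toℕ (f x) <? l) (universal (λ x → toℕ<n (f x)) xs))

  lookup-injective : {xs : List A} → Unique xs → ∀ {i j} → lookup xs i ≡ lookup xs j → i ≡ j
  lookup-injective (_ ∷ _) {zero}  {zero}  eq = refl
  lookup-injective (p ∷ _) {zero}  {suc j} eq = ⊥-elim (All.lookup p (∈-lookup j) eq)
  lookup-injective (p ∷ _) {suc i} {zero}  eq = ⊥-elim (All.lookup p (∈-lookup i) (sym eq))
  lookup-injective (_ ∷ u) {suc i} {suc j} eq = cong suc (lookup-injective u eq)

open Counting

Covers : ∀ {n l u m} → (Fin n → Fin l) → (Fin u → Fin l) → (Fin m → Fin n) → Set
Covers a g f = ∀ x → ∃ λ y → g y ≡ a (f x)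

module _ {n l} (a : Fin n → Fin l) where

  covered? : ∀ {u} (g : Fin u → Fin l) → Decidable (λ i → ∃ λ y → g y ≡ a i)
  covered? g i = any? (λ y → g y ≟ᶠ a i)

  covered : ∀ {u} → (Fin u → Fin l) → ℕ
  covered g = count (covered? g) (allFin n)

  -- Greedily adding fibres: while fewer than m points are covered, more than l * k are not,
  -- so some fibre contains more than k uncovered points.
  greedy : ∀ {m k} → Fin l → l * k + m ≤ n → ∀ u →
           Σ (Fin u → Fin l) λ g → m ≤ covered g ⊎ u * suc k ≤ covered g
  greedy y₀ big zero = (λ ()) , inj₂ z≤n
  greedy {m} {k} y₀ big (suc u) with greedy {m} {k} y₀ big u
  ... | g , g-large with m ≤? covered g | g-large
  -- Enough points are covered already; `y₀` merely fills the slot.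
  ... | yes m≤ | _ = (y₀ Vector.∷ g) , inj₁ (≤-trans m≤ (≤-trans (m≤m+n _ _)
          (count-∪ (covered? g) (covered? g) (covered? (y₀ Vector.∷ g)) later later (allFin n))))
    where
    later : ∀ {i} → (∃ λ y → g y ≡ a i) → ∃ λ y → (y₀ Vector.∷ g) y ≡ a i
    later (y , eq) = suc y , eq
  ... | no  m≰ | inj₁ m≤  = ⊥-elim (m≰ m≤)
  ... | no  m≰ | inj₂ uk≤ = (y Vector.∷ g) , inj₂ (≤-trans (+-mono-≤ k<y uk≤)
          (≤-trans (≤-reflexive (+-comm _ (covered g)))
            (count-∪ (covered? g) (λ i → a i ≟ᶠ y) (covered? (y Vector.∷ g))
              (λ (z , eq) → suc z , eq) (λ eq → zero , sym eq) (allFin n))))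
    where
    rest : List (Fin n)
    rest = filter (¬? ∘ covered? g) (allFin n)
    many : l * k < length rest
    many = +-cancelˡ-< (covered g) _ _ (<-≤-trans
      (≤-trans (s≤s (≤-reflexive (+-comm (covered g) _))) (≤-trans (≤-reflexive (sym (+-suc _ _)))
        (≤-trans (+-monoʳ-≤ (l * k) (≰⇒> m≰)) big)))
      (≤-reflexive (trans (sym (length-tabulate id)) (sym (count-∁ (covered? g) (allFin n))))))
    y : Fin l
    y = proj₁ (large-fibre a rest k many)
    k<y : k < count (λ i → a i ≟ᶠ y) rest
    k<y = proj₂ (large-fibre a rest k many)

  cover : ∀ {m k} u → Fin l → l * k + m ≤ n → m ≤ u * suc k →
          Σ (Fin u → Fin l) λ g → Σ (Fin m → Fin n) λ f → Injective _≡_ _≡_ f × Covers a g f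
  cover {m} {k} u y₀ big m≤uk with greedy {m} {k} y₀ big u
  ... | g , large = g , f , f-inj ,
      λ x → All.lookup (all-filter (covered? g) (allFin n)) (∈-lookup (inject≤ x m≤))
    where
    m≤ : m ≤ covered g
    m≤ = [ id , ≤-trans m≤uk ]′ large
    f : Fin m → Fin n
    f x = lookup (filter (covered? g) (allFin n)) (inject≤ x m≤)
    f-inj : Injective _≡_ _≡_ f
    f-inj eq = inject≤-injective m≤ m≤ _ _ (lookup-injective (filter⁺ (covered? g) (allFin⁺ n)) eq)

suc≤2^ : ∀ e → suc e ≤ 2 ^ e
suc≤2^ zero    = ≤-refl
suc≤2^ (suc e) = +-mono-≤ (m^n>0 2 e) (≤-trans (suc≤2^ e) (m≤m+n _ _))

-- If `m < m′`, the labels of any `m` points suffice. If `m > m′`, the greedy choice of `m′ - 1`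
-- fibres is made with `k = 2 ^ e`, where `m = m′ + 1 + e`.
small-cover : ∀ {m m′} → 3 ≤ m → 3 ≤ m′ → m ≢ m′ → (a : Fin (2 ^ m) → Fin (2 ^ m′)) →
              ∃ λ u → u < m′ × Σ (Fin u → Fin (2 ^ m′)) λ g → Σ (Fin m → Fin (2 ^ m)) λ f →
                Injective _≡_ _≡_ f × Covers a g f
small-cover {m} {m′} 3≤m 3≤m′ m≢m′ a with <-cmp m m′
... | tri< m<m′ _ _ = m , m<m′ , a ∘ f , f , inject≤-injective _ _ _ _ , λ x → x , refl
  where
  f : Fin m → Fin (2 ^ m)
  f x = inject≤ x (≤-trans (n≤1+n m) (suc≤2^ m))
... | tri≈ _ m≡m′ _ = ⊥-elim (m≢m′ m≡m′)
small-cover {m} {suc (suc (suc c))} 3≤m (s≤s (s≤s (s≤s z≤n))) m≢m′ a | tri> _ _ m′<m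
  with m≤n⇒∃[o]m+o≡n m′<m
... | e , refl = suc (suc c) , ≤-refl ,
      cover a {k = 2 ^ e} (suc (suc c)) (fromℕ< (m^n>0 2 m′)) big enough
  where
  m′ : ℕ
  m′ = suc (suc (suc c))
  -- One half of `2 ^ m` equals `2 ^ m′ * 2 ^ e`, and the other half is at least `m`.
  big : 2 ^ m′ * 2 ^ e + suc (m′ + e) ≤ 2 ^ suc (m′ + e)
  big = +-mono-≤ (≤-reflexive (sym (^-distribˡ-+-* 2 m′ e)))
          (≤-trans (suc≤2^ (m′ + e)) (m≤m+n _ _))
  -- Of the `c + 2` fibres, one contributes at least `e + 2` points, a second at least `2`, and the
  -- others at least `1` each, which adds up to `m`.
  enough : suc (m′ + e) ≤ suc (suc c) * suc (2 ^ e)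
  enough = ≤-trans (≤-reflexive (arrange c e))
    (+-mono-≤ (s≤s (suc≤2^ e)) (+-mono-≤ (s≤s (m^n>0 2 e))
      (≤-trans (≤-reflexive (sym (*-identityʳ c))) (*-monoʳ-≤ c (s≤s z≤n)))))
    where
    arrange : ∀ c e → suc (3 + c + e) ≡ (2 + e) + (2 + c)
    arrange = solve-∀

-- From a morphism to a contradiction

module Periodic (n : ℕ) .{{_ : NonZero n}} where

  label : ℕ → Fin n
  label r = fromℕ< (m%n<n r n)

  label-unbounded : ∀ j → Unbounded (λ r → label r ≡ j)
  label-unbounded j N = toℕ j + N * n , ≤-trans (m≤m*n N n) (m≤n+m _ (toℕ j)) ,
    toℕ-injective (trans (toℕ-fromℕ< _)
      (trans ([m+kn]%n≡m%n (toℕ j) N n) (m<n⇒m%n≡m (toℕ<n j))))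

module _ (em : ExcludedMiddle 0ℓ) where
  open Classical em

  module Reduction {n m n′ m′ : ℕ} .{{_ : NonZero n′}} (μ : BorelTukeyMorphism n m n′ m′) where
    open BorelTukeyMorphism μ
    open Periodic n′
    open Coding label

    β : InfSet → Fin n → ℕ → Bool
    β b i x = φ (code b) (i , x)

    β-Ramsey : ∀ i x → Ramsey (λ b → β b i x ≡ true)
    β-Ramsey i x t S =
      let B , B⇔ = φ-borel (i , x) true
          S′ , S′⊆S , h = Borel-Ramsey B t S
      in S′ , S′⊆S , Homogeneous-⇔ (λ b → Equivalence.from (B⇔ (code b)))
                                    (λ b → Equivalence.to (B⇔ (code b))) h

    code-infinite : ∀ b → AllInfinite (code b)
    code-infinite b j N =
      let r , N≤r , eq = label-unbounded j N
      in enum b r , ≤-trans N≤r (k≤enum b r) , code⁺ {b} {j} (r , refl , eq)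

    open Game label β (λ b → φ-infin (code b) (code-infinite b)) (skeleton β β-Ramsey) public
      using (a; colour; module Adversary)

    -- With `J` the range of `g`, the colouring splits `m` coordinates of `φ (code b)`, so
    -- `ψ colour` must split `m′` coordinates of `code b`. These all have labels in `J`, which would
    -- inject `Fin m′` into `Fin u`.
    no-cover : ∀ {u} → u < m′ → (g : Fin u → Fin n′) (f : Fin m → Fin n) → Injective _≡_ _≡_ f →
               ¬ Covers a g f
    no-cover u<m′ g f f-inj cov =
      let b , split , unsplit = Adversary.defeat (ψ colour) (λ j → ∃ λ y → g y ≡ j)
          h , h-inj , h-split = morphism (code b) colour (code-infinite b)
                                  (f , f-inj , λ x → split (f x) (cov x))
          inside = λ x → ¬¬-elim λ x∉ → unsplit (h x) x∉ (h-split x)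
      in <⇒≱ u<m′ (injective⇒≤ {f = proj₁ ∘ inside} λ {x} {y} eq →
           h-inj (trans (sym (proj₂ (inside x))) (trans (cong g eq) (proj₂ (inside y)))))

theorem5p2 : ExcludedMiddle 0ℓ → (m m' : ℕ) → 3 ≤ m → 3 ≤ m' → m ≢ m' →
    ¬ BorelTukeyMorphism (2 ^ m) m (2 ^ m') m'
theorem5p2 em m m' 3≤m 3≤m' m≢m' μ =
  let u , u<m′ , g , f , f-inj , cov = small-cover 3≤m 3≤m' m≢m' a
  in no-cover u<m′ g f f-inj cov
  where
  open Reduction em {{m^n≢0 2 m'}} μ
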